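{- There exist an absolute constant $c$ and an online algorithm for the code reallocation problem (defined in the context) whose amortized number of reassignments per request is at most $c$: for every height $n$, every $m\ge 1$ and every sequence of requests $R_1,\dots,R_m$ served by the algorithm starting from the empty code assignment $F_0=\emptyset$, such that every insertion request can be satisfied by the available bandwidth, the code assignments $F_1,\dots,F_m$ produced by the algorithm satisfy $$\frac1m\sum_{t=0}^{m-1}\bigl|F_{t+1}\setminus F_t\bigr|\le c .$$ In particular $c$ does not depend on $n$, $m$ or the sequence of requests.
   Context: Consider a complete binary tree $T=(V,E)$ of height $n$; leaves are at level $0$ and the root is at level $n$. A request vector is $\boldsymbol r=(r_0,\dots,r_n)\in\mathbb N^{n+1}$. A code assignment of $\boldsymbol r$ is a set $F\subset V$ such that every path from a leaf to the root contains at most one vertex of $F$ and $F$ contains exactly $r_i$ vertices of level $i$ for each $i$. Code reallocation problem: requests arrive one at a time. Suppose that after $t$ requests the request vector is $\boldsymbol r_t=(r_0,\dots,r_n)$ and the code assignment is $F_t$. The next request is one of the following. (A) Insertion at level $i$: the algorithm must output a code assignment $F_{t+1}$ of the request vector $\boldsymbol r_{t+1}=(r_0,\dots,r_i+1,\dots,r_n)$. It is assumed that there is enough bandwidth, i.e. $\sum_k r_k2^k\le 2^n$ for the entries $r_k$ of $\boldsymbol r_{t+1}$. (B') Deletion of a particular vertex $v\in F_t$ (say of level $i$): the new request vector is $(r_0,\dots,r_i-1,\dots,r_n)$ and $F_{t+1}=F_t\setminus\{v\}$. An algorithm is online if $F_{t+1}$ depends only on the requests received up to and including the $(t+1)$-st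 one (and on the algorithm's own previous assignments). A request may depend on the assignments produced so far (a deletion request names a vertex of the current $F_t$). -}

module Defs where

open import Data.Bool as Bool using (Bool; true; false; _∧_; not)
open import Data.Fin as Fin using (Fin; zero; suc; toℕ; fromℕ; inject₁)
open import Data.Integer using (+_)
open import Data.List using (List; []; _∷_; _++_; map; length; filterᵇ)
open import Data.List.Membership.Propositional using () renaming (_∈_ to _∈ᴸ_)
open import Data.Nat using (ℕ; zero; suc; pred; _*_; _^_; _≤_; NonZero)
open import Data.Nat.Properties using (+-0-commutativeMonoid)
open import Data.Product using (_×_; _,_)
open import Data.Rational using (ℚ; _/_)
open import Data.Vec.Functional using (Vector; updateAt; replicate)
open import Relation.Binary.PropositionalEquality using (_≡_; refl)
open import Relation.Nullary using (Dec; yes; no; does)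
open import Algebra.Properties.CommutativeMonoid.Sum +-0-commutativeMonoid using (sum)

-- The vertices of the complete binary tree of height n: the root, or a vertex
-- of one of the two subtrees of height n - 1 hanging below it.
data Vertex : ℕ → Set where
  root  : ∀ {n} → Vertex n
  child : ∀ {n} → Bool → Vertex n → Vertex (suc n)

_≟_ : ∀ {n} (u v : Vertex n) → Dec (u ≡ v)
root      ≟ root      = yes refl
root      ≟ child _ _ = no λ ()
child _ _ ≟ root      = no λ ()
child b u ≟ child c v with b Bool.≟ c | u ≟ v
... | yes refl | yes refl = yes refl
... | no b≢c   | _        = no λ { refl → b≢c refl }
... | yes _    | no u≢v   = no λ { refl → u≢v refl }

vertices : ∀ n → List (Vertex n)
vertices zero    = root ∷ []
vertices (suc n) = root ∷ map (child false) (vertices n) ++ map (child true) (vertices n)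

-- Levels are counted from the leaves: the root has level n, and passing to the
-- ambient tree does not change the level of a vertex of a subtree.
level : ∀ {n} → Vertex n → Fin (suc n)
level {n} root  = fromℕ n
level (child _ v) = inject₁ (level v)

IsLeaf : ∀ {n} → Vertex n → Set
IsLeaf v = level v ≡ zero

pathToRoot : ∀ {n} → Vertex n → List (Vertex n)
pathToRoot root        = root ∷ []
pathToRoot (child b v) = map (child b) (pathToRoot v) ++ root ∷ []

VertexSet : ℕ → Set
VertexSet n = Vertex n → Bool

module _ {n : ℕ} where

  infix  4 _∈_
  infixl 6 _∖_ _∩_

  _∈_ : Vertex n → VertexSet n → Set
  v ∈ F = F v ≡ true

  ∅ : VertexSet n
  ∅ _ = false

  ⁅_⁆ : Vertex n → VertexSet n
  ⁅ v ⁆ u = does (u ≟ v)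

  _∩_ _∖_ : VertexSet n → VertexSet n → VertexSet n
  (F ∩ G) v = F v ∧ G v
  (F ∖ G) v = F v ∧ not (G v)

  atLevel : Fin (suc n) → VertexSet n
  atLevel i v = does (level v Fin.≟ i)

  ∣_∣ : VertexSet n → ℕ
  ∣ F ∣ = length (filterᵇ F (vertices n))

RequestVector : ℕ → Set
RequestVector n = Vector ℕ (suc n)

record IsCodeAssignment {n} (r : RequestVector n) (F : VertexSet n) : Set where
  field
    atMostOne : ∀ ℓ → IsLeaf ℓ → ∀ {u v} →
                u ∈ᴸ pathToRoot ℓ → v ∈ᴸ pathToRoot ℓ → u ∈ F → v ∈ F → u ≡ v
    levelCount : ∀ i → ∣ F ∩ atLevel i ∣ ≡ r i

data Request (n : ℕ) : Set where
  insertion : Fin (suc n) → Request n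
  deletion  : Vertex n → Request n

-- The `pred` is never applied to 0 when the deleted vertex is assigned.
update : ∀ {n} → RequestVector n → Request n → RequestVector n
update r (insertion i) = updateAt r i suc
update r (deletion v)  = updateAt r (level v) pred

-- The requests served so far, each with the assignment produced in response,
-- most recent first.
History : ℕ → Set
History n = List (Request n × VertexSet n)

assignment : ∀ {n} → History n → VertexSet n
assignment []            = ∅
assignment ((_ , F) ∷ _) = F

requestVector : ∀ {n} → History n → RequestVector n
requestVector {n} []      = replicate (suc n) 0
requestVector ((R , _) ∷ h) = update (requestVector h) R

Admissible : ∀ {n} → History n → Request n → Set
Admissible {n} h R@(insertion _) =
  sum (λ k → update (requestVector h) R k * 2 ^ toℕ k) ≤ 2 ^ n
Admissible h (deletion v) = v ∈ assignment h

-- An online algorithm answers an insertion at the given level from the past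
-- alone.  It has no choice at deletions, which are handled by `serve`.
OnlineAlgorithm : Set
OnlineAlgorithm = ∀ n → History n → Fin (suc n) → VertexSet n

module _ (A : OnlineAlgorithm) {n : ℕ} where

  serve : History n → Request n → VertexSet n
  serve h (insertion i) = A n h i
  serve h (deletion v)  = assignment h ∖ ⁅ v ⁆

  -- The history after t of the requests R have been served, starting from h.
  -- Here R zero is the first request.
  serveFrom : ∀ {m} → History n → Vector (Request n) m → Fin (suc m) → History n
  serveFrom         h R zero    = h
  serveFrom {suc m} h R (suc t) =
    serveFrom ((R zero , serve h (R zero)) ∷ h) (λ s → R (suc s)) t

  module _ {m : ℕ} (R : Vector (Request n) m) where

    history : Fin (suc m) → History n
    history = serveFrom [] R

    AdmissibleSequence : Set
    AdmissibleSequence = ∀ t → Admissible (history (inject₁ t)) (R t)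

    reassignments : Fin m → ℕ
    reassignments t = ∣ assignment (history (suc t)) ∖ assignment (history (inject₁ t)) ∣

    averageReassignments : .{{_ : NonZero m}} → ℚ
    averageReassignments = + sum reassignments / m

SolvesCodeReallocation : OnlineAlgorithm → Set
SolvesCodeReallocation A =
  ∀ n m (R : Vector (Request n) m) → AdmissibleSequence A R →
  ∀ t → IsCodeAssignment (requestVector (history A R t)) (assignment (history A R t))

{-# OPTIONS --safe #-}

-- Every request vector r within the bandwidth has a canonical assignment that
-- changes in at most 7 vertices when one entry of r changes by one.  It is built
-- from the leaves upwards.  At each level there is a row of subtrees, to which
-- the codes of that level are added at the right end; then neighbours are
-- paired, and a row of odd length is completed by a free subtree.  If the row is
-- odd and a code was available at its right end, the subtree consisting of that
-- code and the free one is not placed yet but stays pending and is moved behind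
-- the codes of the next level, where it is completed further or placed.  So the
-- free space of a run of levels is gathered next to one code, and no carry
-- propagates through the assignment when r changes.
--
-- An insertion is answered by the canonical assignment.  After a deletion the
-- actual assignment may differ from it, and the number of canonical vertices not
-- actually assigned is the potential: a request raises cost plus potential by at
-- most 8.

module Submission where

open import Defs
open import Data.Bool using (Bool; true; false; _∧_; not; _xor_)
open import Data.Bool.Properties
  using (∧-assoc; ∧-comm; ∧-identityʳ; ∧-inverseʳ; ∧-zeroʳ; xor-comm; xor-same)
open import Data.Fin as Fin using (Fin; zero; suc; toℕ; fromℕ; inject₁)
open import Data.Fin.Properties using (inject₁-injective; fromℕ≢inject₁; toℕ-inject₁; toℕ-fromℕ)
open import Data.Fin.Relation.Unary.Top using (view; ‵fromℕ; ‵inject₁)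
import Data.Integer as ℤ
import Data.Integer.Properties as ℤ
open import Data.List using (List; []; _∷_; _++_; _∷ʳ_; map; length; filterᵇ)
open import Data.List.Membership.Propositional using () renaming (_∈_ to _∈ᴸ_)
open import Data.List.Membership.Propositional.Properties using (∈-++⁻; ∈-map⁻)
open import Data.List.Properties using (length-++)
open import Data.List.Relation.Unary.Any using (here)
open import Data.Nat using (ℕ; zero; suc; pred; _+_; _*_; _^_; _<_; z≤n; s≤s; NonZero; ⌈_/2⌉; parity)
  renaming (_≤_ to _≤ᴺ_)
open import Data.Nat.Properties hiding (_≟_)
open import Data.Nat.Tactic.RingSolver using (solve-∀)
open import Algebra.Properties.CommutativeMonoid.Sum +-0-commutativeMonoid
  using (sum; sum-cong-≗; sum-init-last; sum-replicate-zero)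
open import Algebra.Properties.CommutativeSemigroup +-commutativeSemigroup
  using (interchange; x∙yz≈y∙xz)
open import Data.Parity using (0ℙ; 1ℙ)
open import Data.Product using (_×_; _,_; Σ-syntax)
open import Data.Rational using (ℚ; _≤_)
import Data.Rational as ℚ
import Data.Rational.Properties as ℚ
import Data.Rational.Unnormalised as ℚᵘ
import Data.Rational.Unnormalised.Properties as ℚᵘ
open import Data.Sum using (_⊎_; inj₁; inj₂)
open import Data.Vec.Functional using (Vector; updateAt)
open import Data.Vec.Functional.Properties using (updateAt-updates; updateAt-minimal)
open import Function using (_∘_; mk⇔)
open import Relation.Binary.PropositionalEquality
open import Relation.Nullary using (yes; no)
open import Relation.Nullary.Decidable using (does-⇔; dec-true; dec-false)

-- Cardinalities of vertex sets

ind : Bool → ℕ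
ind false = 0
ind true  = 1

private
  count : ∀ {A : Set} → (A → Bool) → List A → ℕ
  count F xs = length (filterᵇ F xs)

  count-∷ : ∀ {A : Set} (F : A → Bool) x xs → count F (x ∷ xs) ≡ ind (F x) + count F xs
  count-∷ F x xs with F x
  ... | false = refl
  ... | true  = refl

  count-++ : ∀ {A : Set} (F : A → Bool) xs ys → count F (xs ++ ys) ≡ count F xs + count F ys
  count-++ F []       ys = refl
  count-++ F (x ∷ xs) ys with F x
  ... | false = count-++ F xs ys
  ... | true  = cong suc (count-++ F xs ys)

  count-map : ∀ {A B : Set} (F : B → Bool) (f : A → B) xs → count F (map f xs) ≡ count (F ∘ f) xs
  count-map F f []       = refl
  count-map F f (x ∷ xs) with F (f x)
  ... | false = count-map F f xs
  ... | true  = cong suc (count-map F f xs)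

  -- Through this and its converse, inequalities between cardinalities reduce to finite case checks
  -- on the indicators at a single vertex.
  count-≤-+ : ∀ {A : Set} {F G H : A → Bool} → (∀ v → ind (F v) ≤ᴺ ind (G v) + ind (H v)) →
              ∀ xs → count F xs ≤ᴺ count G xs + count H xs
  count-≤-+                 F≤G+H []       = z≤n
  count-≤-+ {F = F} {G} {H} F≤G+H (x ∷ xs) = begin
    count F (x ∷ xs)                                        ≡⟨ count-∷ F x xs ⟩
    ind (F x) + count F xs                                  ≤⟨ +-mono-≤ (F≤G+H x) (count-≤-+ F≤G+H xs) ⟩
    (ind (G x) + ind (H x)) + (count G xs + count H xs)     ≡⟨ interchange (ind (G x)) (ind (H x)) (count G xs) (count H xs) ⟩
    (ind (G x) + count G xs) + (ind (H x) + count H xs)     ≡⟨ cong₂ _+_ (count-∷ G x xs) (count-∷ H x xs) ⟨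
    count G (x ∷ xs) + count H (x ∷ xs)                     ∎
    where
    open ≤-Reasoning

  count-+-≤ : ∀ {A : Set} {F G H : A → Bool} → (∀ v → ind (F v) + ind (G v) ≤ᴺ ind (H v)) →
              ∀ xs → count F xs + count G xs ≤ᴺ count H xs
  count-+-≤                 F+G≤H []       = z≤n
  count-+-≤ {F = F} {G} {H} F+G≤H (x ∷ xs) = begin
    count F (x ∷ xs) + count G (x ∷ xs)                     ≡⟨ cong₂ _+_ (count-∷ F x xs) (count-∷ G x xs) ⟩
    (ind (F x) + count F xs) + (ind (G x) + count G xs)     ≡⟨ interchange (ind (F x)) (count F xs) (ind (G x)) (count G xs) ⟩
    (ind (F x) + ind (G x)) + (count F xs + count G xs)     ≤⟨ +-mono-≤ (F+G≤H x) (count-+-≤ F+G≤H xs) ⟩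
    ind (H x) + count H xs                                  ≡⟨ count-∷ H x xs ⟨
    count H (x ∷ xs)                                        ∎
    where
    open ≤-Reasoning

  count-cong : ∀ {A : Set} {F G : A → Bool} → F ≗ G → ∀ xs → count F xs ≡ count G xs
  count-cong                 F≗G []       = refl
  count-cong {F = F} {G} F≗G (x ∷ xs) =
    trans (count-∷ F x xs)
      (trans (cong₂ _+_ (cong ind (F≗G x)) (count-cong F≗G xs)) (sym (count-∷ G x xs)))

card-cong : ∀ {n} {F G : VertexSet n} → F ≗ G → ∣ F ∣ ≡ ∣ G ∣
card-cong {n} F≗G = count-cong F≗G (vertices n)

card-≤-+ : ∀ {n} {F : VertexSet n} (G H : VertexSet n) →
           (∀ v → ind (F v) ≤ᴺ ind (G v) + ind (H v)) → ∣ F ∣ ≤ᴺ ∣ G ∣ + ∣ H ∣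
card-≤-+ {n} _ _ F≤G+H = count-≤-+ F≤G+H (vertices n)

card-+-≤ : ∀ {n} (F G : VertexSet n) {H : VertexSet n} →
           (∀ v → ind (F v) + ind (G v) ≤ᴺ ind (H v)) → ∣ F ∣ + ∣ G ∣ ≤ᴺ ∣ H ∣
card-+-≤ {n} _ _ F+G≤H = count-+-≤ F+G≤H (vertices n)

card-∅ : ∀ n → ∣ ∅ {n} ∣ ≡ 0
-- Pointwise 0 + 0 ≤ 0, so the cardinality k satisfies k + k ≤ k.
card-∅ n = n≤0⇒n≡0 (+-cancelˡ-≤ ∣ ∅ {n} ∣ _ _
  (≤-trans (card-+-≤ ∅ ∅ {∅ {n}} (λ _ → z≤n)) (≤-reflexive (sym (+-identityʳ _)))))

card-child : ∀ {n} (F : VertexSet (suc n)) →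
             ∣ F ∣ ≡ ind (F root) + (∣ F ∘ child false ∣ + ∣ F ∘ child true ∣)
card-child {n} F = trans (count-∷ F root _) (cong (ind (F root) +_)
  (trans (count-++ F (map (child false) (vertices n)) _)
    (cong₂ _+_ (count-map F (child false) (vertices n)) (count-map F (child true) (vertices n)))))

card-⁅⁆ : ∀ {n} (v : Vertex n) → ∣ ⁅ v ⁆ ∣ ≡ 1
card-⁅⁆ {zero}  root = refl
card-⁅⁆ {suc n} root = trans (card-child {n} ⁅ root ⁆) (cong suc (cong₂ _+_ (card-∅ n) (card-∅ n)))
card-⁅⁆ {suc n} (child false v) = trans (card-child ⁅ child false v ⁆)
  (cong₂ _+_ (trans (card-cong same) (card-⁅⁆ v)) (trans (card-cong other) (card-∅ n)))
  where
  same : ∀ u → ⁅ child false v ⁆ (child false u) ≡ ⁅ v ⁆ u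
  same u = does-⇔ (mk⇔ (λ { refl → refl }) (cong (child false))) (child false u ≟ child false v) (u ≟ v)
  other : ∀ u → ⁅ child false v ⁆ (child true u) ≡ false
  other u = dec-false (child true u ≟ child false v) λ ()
card-⁅⁆ {suc n} (child true v) = trans (card-child ⁅ child true v ⁆)
  (cong₂ _+_ (trans (card-cong other) (card-∅ n)) (trans (card-cong same) (card-⁅⁆ v)))
  where
  same : ∀ u → ⁅ child true v ⁆ (child true u) ≡ ⁅ v ⁆ u
  same u = does-⇔ (mk⇔ (λ { refl → refl }) (cong (child true))) (child true u ≟ child true v) (u ≟ v)
  other : ∀ u → ⁅ child true v ⁆ (child false u) ≡ false
  other u = dec-false (child false u ≟ child true v) λ ()

-- Symmetric differences

infixl 6 _△_

-- Unlike the cost of a request, which counts only new vertices, this distance is symmetric. One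
-- bound on it therefore serves both an insertion and a deletion.
_△_ : ∀ {n} → VertexSet n → VertexSet n → VertexSet n
(F △ G) v = F v xor G v

△-triangle : ∀ {n} (F G H : VertexSet n) → ∣ F △ H ∣ ≤ᴺ ∣ F △ G ∣ + ∣ G △ H ∣
△-triangle F G H = card-≤-+ (F △ G) (G △ H) λ v → pointwise (F v) (G v) (H v)
  where
  pointwise : ∀ a b c → ind (a xor c) ≤ᴺ ind (a xor b) + ind (b xor c)
  pointwise false false _     = ≤-refl
  pointwise false true  false = z≤n
  pointwise false true  true  = ≤-refl
  pointwise true  false false = ≤-refl
  pointwise true  false true  = z≤n
  pointwise true  true  _     = ≤-refl

△-comm : ∀ {n} (F G : VertexSet n) → ∣ F △ G ∣ ≡ ∣ G △ F ∣
△-comm F G = card-cong λ v → xor-comm (F v) (G v)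

△-self : ∀ {n} (F : VertexSet n) → ∣ F △ F ∣ ≡ 0
△-self {n} F = trans (card-cong λ v → xor-same (F v)) (card-∅ n)

∖-triangle : ∀ {n} (F G H : VertexSet n) → ∣ F ∖ H ∣ ≤ᴺ ∣ F △ G ∣ + ∣ G ∖ H ∣
∖-triangle F G H = card-≤-+ (F △ G) (G ∖ H) λ v → pointwise (F v) (G v) (H v)
  where
  pointwise : ∀ a b c → ind (a ∧ not c) ≤ᴺ ind (a xor b) + ind (b ∧ not c)
  pointwise false _     _     = z≤n
  pointwise true  false false = ≤-refl
  pointwise true  false true  = z≤n
  pointwise true  true  _     = ≤-refl

-- Subtrees carrying an antichain

data Code : ℕ → Set where
  free full : ∀ {n} → Code n
  node      : ∀ {n} → Code n → Code n → Code (suc n)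

⟦_⟧ : ∀ {n} → Code n → VertexSet n
⟦ free ⟧     _               = false
⟦ full ⟧     root            = true
⟦ full ⟧     (child _ _)     = false
⟦ node a b ⟧ root            = false
⟦ node a b ⟧ (child false v) = ⟦ a ⟧ v
⟦ node a b ⟧ (child true v)  = ⟦ b ⟧ v

-- Nothing is assigned below a `full` root, and the root of a `node` is not assigned. Two codes on
-- one path thus lie in the same child, and induction applies.
⟦⟧-atMostOne : ∀ {n} (c : Code n) ℓ {u v} → u ∈ᴸ pathToRoot ℓ → v ∈ᴸ pathToRoot ℓ →
               u ∈ ⟦ c ⟧ → v ∈ ⟦ c ⟧ → u ≡ v
⟦⟧-atMostOne full _ {root} {root} _ _ _ _ = refl
⟦⟧-atMostOne (node a b) root (here refl) (here refl) ()
⟦⟧-atMostOne (node a b) (child x ℓ) u∈path v∈path u∈c v∈c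
  with ∈-++⁻ (map (child x) (pathToRoot ℓ)) u∈path | ∈-++⁻ (map (child x) (pathToRoot ℓ)) v∈path
⟦⟧-atMostOne (node a b) (child x ℓ) _ _ () _ | inj₂ (here refl) | _
⟦⟧-atMostOne (node a b) (child x ℓ) _ _ _ () | inj₁ _ | inj₂ (here refl)
... | inj₁ u∈map | inj₁ v∈map with x | ∈-map⁻ (child x) u∈map | ∈-map⁻ (child x) v∈map
... | false | _ , u∈ , refl | _ , v∈ , refl = cong (child false) (⟦⟧-atMostOne a ℓ u∈ v∈ u∈c v∈c)
... | true  | _ , u∈ , refl | _ , v∈ , refl = cong (child true)  (⟦⟧-atMostOne b ℓ u∈ v∈ u∈c v∈c)

-- Opaque so that unification recovers the arguments of δ.
opaque
  δ : ∀ {n} → Code n → Code n → ℕ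
  δ a b = ∣ ⟦ a ⟧ △ ⟦ b ⟧ ∣

  δ-card : ∀ {n} (a b : Code n) → δ a b ≡ ∣ ⟦ a ⟧ △ ⟦ b ⟧ ∣
  δ-card a b = refl

  δ-refl : ∀ {n} (a : Code n) → δ a a ≡ 0
  δ-refl a = △-self ⟦ a ⟧

  δ-triangle : ∀ {n} (a b c : Code n) → δ a c ≤ᴺ δ a b + δ b c
  δ-triangle a b c = △-triangle ⟦ a ⟧ ⟦ b ⟧ ⟦ c ⟧

  δ-comm : ∀ {n} (a b : Code n) → δ a b ≡ δ b a
  δ-comm a b = △-comm ⟦ a ⟧ ⟦ b ⟧

  δ-node : ∀ {n} (a b c d : Code n) → δ (node a b) (node c d) ≡ δ a c + δ b d
  δ-node a b c d = card-child (⟦ node a b ⟧ △ ⟦ node c d ⟧)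

  δ-free-node : ∀ {n} (a b : Code n) → δ free (node a b) ≡ δ free a + δ free b
  δ-free-node a b = card-child (⟦ free ⟧ △ ⟦ node a b ⟧)

  δ-free-full : ∀ n → δ {n} free full ≡ 1
  δ-free-full zero    = refl
  δ-free-full (suc n) =
    trans (card-child (⟦ free {suc n} ⟧ △ ⟦ full ⟧)) (cong suc (cong₂ _+_ (card-∅ n) (card-∅ n)))

δ-node-free : ∀ {n} (a b : Code n) → δ (node a b) free ≡ δ a free + δ b free
δ-node-free a b = trans (δ-comm (node a b) free)
  (trans (δ-free-node a b) (cong₂ _+_ (δ-comm free a) (δ-comm free b)))

δ-half : ∀ {n} (x y : Code n) → δ (node x free) (node y free) ≡ δ x y
δ-half x y = trans (δ-node x free y free) (trans (cong (δ x y +_) (δ-refl free)) (+-identityʳ _))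

δ-free-half : ∀ {n} (y : Code n) → δ free (node y free) ≡ δ free y
δ-free-half y = trans (δ-free-node y free) (trans (cong (δ free y +_) (δ-refl free)) (+-identityʳ _))

δ-half-free : ∀ {n} (x : Code n) → δ (node x free) free ≡ δ x free
δ-half-free x = trans (δ-node-free x free) (trans (cong (δ x free +_) (δ-refl free)) (+-identityʳ _))

module _ {n : ℕ} (x : Code n) where

  -- `free` and `full` differ in the root only, so exchanging them shifts a distance by at most one.
  δ-free≤δ-full+1 : δ x free ≤ᴺ δ x full + 1
  δ-free≤δ-full+1 = subst (λ k → δ x free ≤ᴺ δ x full + k) (trans (δ-comm full free) (δ-free-full n))
    (δ-triangle x full free)

  δ-full≤δ-free+1 : δ x full ≤ᴺ δ x free + 1
  δ-full≤δ-free+1 = subst (λ k → δ x full ≤ᴺ δ x free + k) (δ-free-full n) (δ-triangle x free full)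

-- Rows of subtrees

Row : ℕ → Set
Row n = List (Code n)

-- Rows of different lengths are compared as if continued by free subtrees.
D : ∀ {n} → Row n → Row n → ℕ
D []       []       = 0
D []       (y ∷ ys) = δ free y + D [] ys
D (x ∷ xs) []       = δ x free + D xs []
D (x ∷ xs) (y ∷ ys) = δ x y + D xs ys

D-refl : ∀ {n} (xs : Row n) → D xs xs ≡ 0
D-refl []       = refl
D-refl (x ∷ xs) = cong₂ _+_ (δ-refl x) (D-refl xs)

D-triangle : ∀ {n} (xs ys zs : Row n) → D xs zs ≤ᴺ D xs ys + D ys zs
D-triangle xs ys zs = go xs ys zs
  where
  step : ∀ {n} (x y z : Code n) {k l m} → m ≤ᴺ k + l → δ x z + m ≤ᴺ (δ x y + k) + (δ y z + l)
  step x y z {k} {l} m≤ = ≤-trans (+-mono-≤ (δ-triangle x y z) m≤)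
    (≤-reflexive (interchange (δ x y) (δ y z) k l))
  skip : ∀ {n} (y : Code n) {k l m} → m ≤ᴺ k + l → m ≤ᴺ (δ free y + k) + (δ y free + l)
  -- The two outer rows have ended and count as free here; their mutual distance is added on the
  -- left so that `step` applies.
  skip {n} y m≤ = ≤-trans (m≤n+m _ (δ {n} free free)) (step free y free m≤)
  go : ∀ {n} (xs ys zs : Row n) → D xs zs ≤ᴺ D xs ys + D ys zs
  go []       []       []       = z≤n
  go []       []       (z ∷ zs) = ≤-refl
  go []       (y ∷ ys) []       = skip y (go [] ys [])
  go []       (y ∷ ys) (z ∷ zs) = step free y z (go [] ys zs)
  go (x ∷ xs) []       []       = ≤-reflexive (sym (+-identityʳ _))
  go (x ∷ xs) []       (z ∷ zs) = step x free z (go xs [] zs)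
  go (x ∷ xs) (y ∷ ys) []       = step x y free (go xs ys [])
  go (x ∷ xs) (y ∷ ys) (z ∷ zs) = step x y z (go xs ys zs)

D-∷ʳ : ∀ {n} (xs ys : Row n) {x y} → length ys ≡ length xs → D (xs ∷ʳ x) (ys ∷ʳ y) ≡ D xs ys + δ x y
D-∷ʳ []       []       {x} {y} _  = +-identityʳ (δ x y)
D-∷ʳ (a ∷ xs) (b ∷ ys) eq =
  trans (cong (δ a b +_) (D-∷ʳ xs ys (suc-injective eq))) (sym (+-assoc (δ a b) _ _))

-- The last entry stands beyond the end of `xs`, opposite a free subtree.
D-∷ʳʳ : ∀ {n} (xs ys : Row n) {y} → length xs ≤ᴺ length ys → D xs (ys ∷ʳ y) ≡ D xs ys + δ free y
D-∷ʳʳ []       []       {y} _  = +-identityʳ (δ free y)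
D-∷ʳʳ []       (b ∷ ys) _ =
  trans (cong (δ free b +_) (D-∷ʳʳ [] ys z≤n)) (sym (+-assoc (δ free b) _ _))
D-∷ʳʳ (a ∷ xs) (b ∷ ys) (s≤s len≤) =
  trans (cong (δ a b +_) (D-∷ʳʳ xs ys len≤)) (sym (+-assoc (δ a b) _ _))

D-∷ʳˡ : ∀ {n} (xs : Row n) x → D (xs ∷ʳ x) xs ≡ δ x free
D-∷ʳˡ []       x = +-identityʳ (δ x free)
D-∷ʳˡ (a ∷ xs) x = cong₂ _+_ (δ-refl a) (D-∷ʳˡ xs x)

-- Pairing neighbours

pair : ∀ {n} → Row n → Row (suc n)
pair []           = []
pair (x ∷ [])     = node x free ∷ []
pair (x ∷ y ∷ zs) = node x y ∷ pair zs

length-pair : ∀ {n} (xs : Row n) → length (pair xs) ≡ ⌈ length xs /2⌉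
length-pair []           = refl
length-pair (x ∷ [])     = refl
length-pair (x ∷ y ∷ zs) = cong suc (length-pair zs)

-- The new roots carry no code, and the free sibling that completes an odd row agrees with the
-- padding in `D`. Passing to the next level is therefore free of cost.
D-pair : ∀ {n} (xs ys : Row n) → D (pair xs) (pair ys) ≡ D xs ys
D-pair []            []            = refl
D-pair []            (y ∷ [])      =
  cong (_+ 0) (δ-free-half y)
D-pair []            (y ∷ y′ ∷ ys) =
  trans (cong₂ _+_ (δ-free-node y y′) (D-pair [] ys)) (+-assoc (δ free y) _ _)
D-pair (x ∷ [])      []            =
  cong (_+ 0) (δ-half-free x)
D-pair (x ∷ x′ ∷ xs) []            =
  trans (cong₂ _+_ (δ-node-free x x′) (D-pair xs [])) (+-assoc (δ x free) _ _)
D-pair (x ∷ [])      (y ∷ [])      =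
  cong (_+ 0) (δ-half x y)
D-pair (x ∷ [])      (y ∷ y′ ∷ ys) =
  trans (cong₂ _+_ (δ-node x free y y′) (D-pair [] ys)) (+-assoc (δ x y) _ _)
D-pair (x ∷ x′ ∷ xs) (y ∷ [])      =
  trans (cong₂ _+_ (δ-node x x′ y free) (D-pair xs [])) (+-assoc (δ x y) _ _)
D-pair (x ∷ x′ ∷ xs) (y ∷ y′ ∷ ys) =
  trans (cong₂ _+_ (δ-node x x′ y y′) (D-pair xs ys)) (+-assoc (δ x y) _ _)

-- The canonical layout

-- A pending subtree contains a single code (see `Light`).
data State (n : ℕ) : Set where
  settled : Row n → State n
  pending : Row n → Code n → State n

entries : ∀ {n} → State n → Row n
entries (settled xs)   = xs
entries (pending xs x) = xs ∷ʳ x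

push : ∀ {n} → State n → State n
push (settled xs)   = pending xs full
push (pending xs x) = pending (xs ∷ʳ full) x

-- A row of even length has no partner left for the pending subtree, which takes a free one and
-- remains movable. A row of odd length has a vacancy, and there the subtree is placed.
lift : ∀ {n} → State n → State (suc n)
lift (settled xs)   = settled (pair xs)
lift (pending xs x) with parity (length xs)
... | 0ℙ = pending (pair xs) (node x free)
... | 1ℙ = settled (pair (xs ∷ʳ x))

pushes : ∀ {n} → ℕ → State n → State n
pushes zero    s = s
pushes (suc k) s = push (pushes k s)

build : ∀ n → RequestVector n → State n
build zero    r = pushes (r zero) (settled [])
build (suc n) r = pushes (r (fromℕ (suc n))) (lift (build n (r ∘ inject₁)))

-- Within the bandwidth the last row has at most one entry, the whole tree; an empty row means that
-- no code is assigned.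
first : ∀ {n} → Row n → Code n
first []      = free
first (x ∷ _) = x

layout : ∀ {n} → RequestVector n → Code n
layout {n} r = first (entries (build n r))

δ-first : ∀ {n} (xs ys : Row n) → δ (first xs) (first ys) ≤ᴺ D xs ys
δ-first []       []       = ≤-reflexive (δ-refl free)
δ-first []       (y ∷ ys) = m≤m+n _ _
δ-first (x ∷ xs) []       = m≤m+n _ _
δ-first (x ∷ xs) (y ∷ ys) = m≤m+n _ _

-- One more code

-- The ways in which the states for r and for r with one more code can differ.
-- The first two lead to each other, then to the third or to the last two, and
-- the third leads to the last two.  The bound grows by 2 on entering and on
-- leaving the third.
data Near {n} : State n → State n → Set where
  extra-pending : ∀ {xs ys y} → length ys ≡ length xs → D xs ys + δ free y ≤ᴺ 3 →
                  Near (settled xs) (pending ys y)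
  extra-full    : ∀ {xs x ys y} → length ys ≡ suc (length xs) →
                  D (xs ∷ʳ full) ys + δ x full + δ free y ≤ᴺ 3 → Near (pending xs x) (pending ys y)
  pending-moved : ∀ {xs x ys} → length ys ≡ suc (length xs) → D xs ys + δ x free ≤ᴺ 5 →
                  Near (pending xs x) (settled ys)
  both-settled  : ∀ {xs ys} → length ys ≡ length xs → D xs ys ≤ᴺ 7 →
                  Near (settled xs) (settled ys)
  both-pending  : ∀ {xs x ys y} → length ys ≡ length xs → D xs ys + δ x y ≤ᴺ 7 →
                  Near (pending xs x) (pending ys y)

private
  length-∷ʳ : ∀ {A : Set} (xs : List A) {x} → length (xs ∷ʳ x) ≡ suc (length xs)
  length-∷ʳ xs = trans (length-++ xs) (+-comm _ 1)

  -- One more entry opens a new pair after an even length and fills the last pair after an odd one.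
  -- Parity is kept together with the rounding because `lift` branches on it.
  parity-suc : ∀ n → (parity n ≡ 0ℙ × parity (suc n) ≡ 1ℙ × ⌈ suc n /2⌉ ≡ suc ⌈ n /2⌉)
                   ⊎ (parity n ≡ 1ℙ × parity (suc n) ≡ 0ℙ × ⌈ suc n /2⌉ ≡ ⌈ n /2⌉)
  parity-suc zero          = inj₁ (refl , refl , refl)
  parity-suc (suc zero)    = inj₂ (refl , refl , refl)
  parity-suc (suc (suc n)) with parity-suc n
  ... | inj₁ (p , q , e) = inj₁ (p , q , cong suc e)
  ... | inj₂ (p , q , e) = inj₂ (p , q , cong suc e)

lift-even : ∀ {n} (xs : Row n) {x} → parity (length xs) ≡ 0ℙ →
            lift (pending xs x) ≡ pending (pair xs) (node x free)
lift-even xs p rewrite p = refl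

lift-odd : ∀ {n} (xs : Row n) {x} → parity (length xs) ≡ 1ℙ →
           lift (pending xs x) ≡ settled (pair (xs ∷ʳ x))
lift-odd xs p rewrite p = refl

length-pair-cong : ∀ {n} (xs ys : Row n) → length ys ≡ length xs → length (pair ys) ≡ length (pair xs)
length-pair-cong xs ys eq = trans (length-pair ys) (trans (cong ⌈_/2⌉ eq) (sym (length-pair xs)))

D-replace-last : ∀ {n} (xs ys : Row n) x y → D (xs ∷ʳ x) ys ≤ᴺ D (xs ∷ʳ y) ys + δ x y
D-replace-last xs ys x y = begin
  D (xs ∷ʳ x) ys                        ≤⟨ D-triangle (xs ∷ʳ x) (xs ∷ʳ y) ys ⟩
  D (xs ∷ʳ x) (xs ∷ʳ y) + D (xs ∷ʳ y) ys ≡⟨ cong (_+ D (xs ∷ʳ y) ys) (trans (D-∷ʳ xs xs refl) (cong (_+ δ x y) (D-refl xs))) ⟩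
  δ x y + D (xs ∷ʳ y) ys                ≡⟨ +-comm (δ x y) _ ⟩
  D (xs ∷ʳ y) ys + δ x y                ∎
  where open ≤-Reasoning

D-append-last : ∀ {n} (xs ys : Row n) x → D (xs ∷ʳ x) ys ≤ᴺ D xs ys + δ x free
D-append-last xs ys x = begin
  D (xs ∷ʳ x) ys              ≤⟨ D-triangle (xs ∷ʳ x) xs ys ⟩
  D (xs ∷ʳ x) xs + D xs ys    ≡⟨ cong (_+ D xs ys) (D-∷ʳˡ xs x) ⟩
  δ x free + D xs ys          ≡⟨ +-comm (δ x free) _ ⟩
  D xs ys + δ x free          ∎
  where open ≤-Reasoning

D-drop-last : ∀ {n} (xs ys : Row n) x → D xs ys ≤ᴺ D (xs ∷ʳ x) ys + δ free x
D-drop-last xs ys x = begin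
  D xs ys                           ≤⟨ D-triangle xs (xs ∷ʳ x) ys ⟩
  D xs (xs ∷ʳ x) + D (xs ∷ʳ x) ys   ≡⟨ cong (_+ D (xs ∷ʳ x) ys) (trans (D-∷ʳʳ xs xs ≤-refl) (cong (_+ δ free x) (D-refl xs))) ⟩
  δ free x + D (xs ∷ʳ x) ys         ≡⟨ +-comm (δ free x) _ ⟩
  D (xs ∷ʳ x) ys + δ free x         ∎
  where open ≤-Reasoning

-- The new codes face each other in the comparison, so the distance is unchanged except after
-- `pending-moved`.
near-push : ∀ {n} {s t : State n} → Near s t → Near (push s) (push t)
near-push {n} (extra-pending {xs} {ys} {y} len d) =
  extra-full (trans (length-∷ʳ ys) (cong suc len)) (begin
    D (xs ∷ʳ full) (ys ∷ʳ full) + δ {n} full full + δ free y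
      ≡⟨ cong (λ k → k + δ free y) (cong₂ _+_ (trans (D-∷ʳ xs ys len) (cong (D xs ys +_) (δ-refl {n} full))) (δ-refl {n} full)) ⟩
    D xs ys + 0 + 0 + δ free y ≡⟨ cong (_+ δ free y) (trans (+-identityʳ _) (+-identityʳ _)) ⟩
    D xs ys + δ free y ≤⟨ d ⟩
    3 ∎)
  where open ≤-Reasoning
near-push {n} (extra-full {xs} {x} {ys} {y} len d) =
  extra-full (trans (length-∷ʳ ys) (cong suc (trans len (sym (length-∷ʳ xs))))) (begin
    D (xs ∷ʳ full ∷ʳ full) (ys ∷ʳ full) + δ x full + δ free y
      ≡⟨ cong (λ k → k + δ x full + δ free y) (trans (D-∷ʳ (xs ∷ʳ full) ys (trans len (sym (length-∷ʳ xs))))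
           (trans (cong (D (xs ∷ʳ full) ys +_) (δ-refl {n} full)) (+-identityʳ _))) ⟩
    D (xs ∷ʳ full) ys + δ x full + δ free y ≤⟨ d ⟩
    3 ∎)
  where open ≤-Reasoning
-- On the left the new code is placed, opposite the last entry of `ys`; on the right it becomes
-- pending, opposite `x`. Both were compared with `free` before and are now compared with `full`,
-- which costs one each.
near-push (pending-moved {xs} {x} {ys} len d) =
  both-pending (trans len (sym (length-∷ʳ xs))) (begin
    D (xs ∷ʳ full) ys + δ x full
      ≤⟨ +-mono-≤ (D-append-last xs ys full) (δ-full≤δ-free+1 x) ⟩
    (D xs ys + δ full free) + (δ x free + 1)
      ≡⟨ cong (λ k → (D xs ys + k) + (δ x free + 1)) (trans (δ-comm full free) (δ-free-full _)) ⟩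
    (D xs ys + 1) + (δ x free + 1) ≡⟨ interchange (D xs ys) 1 (δ x free) 1 ⟩
    (D xs ys + δ x free) + 2 ≤⟨ +-monoˡ-≤ 2 d ⟩
    7 ∎)
  where open ≤-Reasoning
near-push {n} (both-settled {xs} {ys} len d) =
  both-pending len (subst (_≤ᴺ 7) (sym (trans (cong (D xs ys +_) (δ-refl {n} full)) (+-identityʳ _))) d)
near-push {n} (both-pending {xs} {x} {ys} {y} len d) =
  both-pending (trans (length-∷ʳ ys) (trans (cong suc len) (sym (length-∷ʳ xs))))
    (subst (λ k → k + δ x y ≤ᴺ 7)
      (sym (trans (D-∷ʳ xs ys len) (trans (cong (D xs ys +_) (δ-refl {n} full)) (+-identityʳ _)))) d)

-- Pairing itself preserves distances. What remains is to follow the pending subtrees, and the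
-- parity of the left row decides which of them are placed.
near-lift : ∀ {n} {s t : State n} → Near s t → Near (lift s) (lift t)
near-lift (extra-pending {xs} {ys} {y} len d) with parity-suc (length xs)
... | inj₁ (p , _ , _) rewrite lift-even ys {y} (trans (cong parity len) p) =
  extra-pending (length-pair-cong xs ys len)
    (subst (_≤ᴺ 3) (sym (cong₂ _+_ (D-pair xs ys) (δ-free-half y))) d)
... | inj₂ (p , _ , ceil) rewrite lift-odd ys {y} (trans (cong parity len) p) =
  -- `y` fills the vacancy of an odd row, so the two rows are equally long again.
  both-settled
    (trans (length-pair (ys ∷ʳ y)) (trans (cong ⌈_/2⌉ (trans (length-∷ʳ ys) (cong suc len)))
      (trans ceil (sym (length-pair xs)))))
    (begin
      D (pair xs) (pair (ys ∷ʳ y))  ≡⟨ trans (D-pair xs (ys ∷ʳ y)) (D-∷ʳʳ xs ys (≤-reflexive (sym len))) ⟩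
      D xs ys + δ free y            ≤⟨ d ⟩
      3                             ≤⟨ m≤m+n 3 4 ⟩
      7                             ∎)
  where open ≤-Reasoning
near-lift (extra-full {xs} {x} {ys} {y} len d) with parity-suc (length xs)
... | inj₁ (p , q , _) rewrite lift-even xs {x} p | lift-odd ys {y} (trans (cong parity len) q) =
  -- Only `y` is placed. The comparison with an imaginary `full` at the end of `xs` is given up: the
  -- last entry of `ys` and the subtree `x` are now compared with `free`, which costs one each.
  pending-moved
    (trans (length-pair (ys ∷ʳ y)) (trans (cong ⌈_/2⌉ (trans (length-∷ʳ ys) (cong suc len)))
      (cong suc (sym (length-pair xs)))))
    (begin
      D (pair xs) (pair (ys ∷ʳ y)) + δ (node x free) free
        ≡⟨ cong₂ _+_ (trans (D-pair xs (ys ∷ʳ y)) (D-∷ʳʳ xs ys (≤-trans (n≤1+n _) (≤-reflexive (sym len)))))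
             (δ-half-free x) ⟩
      (D xs ys + δ free y) + δ x free
        ≤⟨ +-mono-≤ (+-monoˡ-≤ (δ free y) (D-drop-last xs ys full)) (δ-free≤δ-full+1 x) ⟩
      ((D (xs ∷ʳ full) ys + δ free full) + δ free y) + (δ x full + 1)
        ≡⟨ cong (λ k → ((D (xs ∷ʳ full) ys + k) + δ free y) + (δ x full + 1)) (δ-free-full _) ⟩
      ((D (xs ∷ʳ full) ys + 1) + δ free y) + (δ x full + 1)
        ≡⟨ rearrange (D (xs ∷ʳ full) ys) (δ free y) (δ x full) ⟩
      (D (xs ∷ʳ full) ys + δ x full + δ free y) + 2
        ≤⟨ +-monoˡ-≤ 2 d ⟩
      5 ∎)
  where
  open ≤-Reasoning
  rearrange : ∀ a b c → ((a + 1) + b) + (c + 1) ≡ (a + c + b) + 2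
  rearrange = solve-∀
... | inj₂ (p , q , _) rewrite lift-odd xs {x} p | lift-even ys {y} (trans (cong parity len) q) =
  -- Now `x` is placed exactly where the comparison had `full`, and the term `δ x full` already pays
  -- for this. Since nothing is added, the two extra cases can alternate over any number of levels.
  extra-pending
    (length-pair-cong (xs ∷ʳ x) ys (trans len (sym (length-∷ʳ xs))))
    (begin
      D (pair (xs ∷ʳ x)) (pair ys) + δ free (node y free)
        ≡⟨ cong₂ _+_ (D-pair (xs ∷ʳ x) ys) (δ-free-half y) ⟩
      D (xs ∷ʳ x) ys + δ free y
        ≤⟨ +-monoˡ-≤ (δ free y) (D-replace-last xs ys x full) ⟩
      D (xs ∷ʳ full) ys + δ x full + δ free y ≤⟨ d ⟩
      3 ∎)
  where open ≤-Reasoning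
near-lift (pending-moved {xs} {x} {ys} len d) with parity-suc (length xs)
... | inj₁ (p , _ , ceil) rewrite lift-even xs {x} p =
  pending-moved
    (trans (length-pair ys) (trans (cong ⌈_/2⌉ len) (trans ceil (cong suc (sym (length-pair xs))))))
    (subst (_≤ᴺ 5) (sym (cong₂ _+_ (D-pair xs ys)
      (δ-half-free x))) d)
... | inj₂ (p , _ , _) rewrite lift-odd xs {x} p =
  both-settled (length-pair-cong (xs ∷ʳ x) ys (trans len (sym (length-∷ʳ xs)))) (begin
    D (pair (xs ∷ʳ x)) (pair ys) ≡⟨ D-pair (xs ∷ʳ x) ys ⟩
    D (xs ∷ʳ x) ys               ≤⟨ D-append-last xs ys x ⟩
    D xs ys + δ x free           ≤⟨ d ⟩
    5                            ≤⟨ m≤m+n 5 2 ⟩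
    7                            ∎)
  where open ≤-Reasoning
near-lift (both-settled {xs} {ys} len d) =
  both-settled (length-pair-cong xs ys len) (subst (_≤ᴺ 7) (sym (D-pair xs ys)) d)
near-lift (both-pending {xs} {x} {ys} {y} len d) with parity-suc (length xs)
... | inj₁ (p , _ , _) rewrite lift-even xs {x} p | lift-even ys {y} (trans (cong parity len) p) =
  both-pending (length-pair-cong xs ys len)
    (subst (_≤ᴺ 7) (sym (cong₂ _+_ (D-pair xs ys) (δ-half x y))) d)
... | inj₂ (p , _ , _) rewrite lift-odd xs {x} p | lift-odd ys {y} (trans (cong parity len) p) =
  both-settled
    (length-pair-cong (xs ∷ʳ x) (ys ∷ʳ y) (trans (length-∷ʳ ys) (trans (cong suc len) (sym (length-∷ʳ xs)))))
    (subst (_≤ᴺ 7) (sym (trans (D-pair (xs ∷ʳ x) (ys ∷ʳ y)) (D-∷ʳ xs ys len))) d)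

near-entries : ∀ {n} {s t : State n} → Near s t → D (entries s) (entries t) ≤ᴺ 7
near-entries (extra-pending {xs} {ys} {y} len d) =
  ≤-trans (≤-reflexive (D-∷ʳʳ xs ys (≤-reflexive (sym len)))) (≤-trans d (m≤m+n 3 4))
near-entries (extra-full {xs} {x} {ys} {y} len d) = begin
  D (xs ∷ʳ x) (ys ∷ʳ y)                     ≡⟨ D-∷ʳʳ (xs ∷ʳ x) ys (≤-reflexive (trans (length-∷ʳ xs) (sym len))) ⟩
  D (xs ∷ʳ x) ys + δ free y                 ≤⟨ +-monoˡ-≤ (δ free y) (D-replace-last xs ys x full) ⟩
  D (xs ∷ʳ full) ys + δ x full + δ free y   ≤⟨ d ⟩
  3                                         ≤⟨ m≤m+n 3 4 ⟩
  7                                         ∎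
  where open ≤-Reasoning
near-entries (pending-moved {xs} {x} {ys} len d) =
  ≤-trans (D-append-last xs ys x) (≤-trans d (m≤m+n 5 2))
near-entries (both-settled len d) = d
near-entries (both-pending {xs} {x} {ys} {y} len d) = ≤-trans (≤-reflexive (D-∷ʳ xs ys len)) d

near-pushes : ∀ {n} k {s t : State n} → Near s t → Near (pushes k s) (pushes k t)
near-pushes zero    st = st
near-pushes (suc k) st = near-push (near-pushes k st)

-- Weight of the pending subtree and the initial difference

data Light {n} : State n → Set where
  settled : ∀ {xs} → Light (settled xs)
  pending : ∀ {xs x} → δ free x ≡ 1 → Light (pending xs x)

light-push : ∀ {n} {s : State n} → Light s → Light (push s)
light-push settled     = pending (δ-free-full _)
light-push (pending p) = pending p

light-pushes : ∀ {n} k {s : State n} → Light s → Light (pushes k s)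
light-pushes zero    s = s
light-pushes (suc k) s = light-push (light-pushes k s)

light-lift : ∀ {n} {s : State n} → Light s → Light (lift s)
light-lift settled = settled
light-lift (pending {xs} {x} p) with parity (length xs)
... | 0ℙ = pending (trans (δ-free-half x) p)
... | 1ℙ = settled

light-build : ∀ n (r : RequestVector n) → Light (build n r)
light-build zero    r = light-pushes (r zero) settled
light-build (suc n) r = light-pushes (r (fromℕ (suc n))) (light-lift (light-build n (r ∘ inject₁)))

-- On a settled row the new code only adds itself. Otherwise it takes the place of the pending `x`,
-- which moves one place on: at most 2 for exchanging `x` with `full`, and 1 for `x` at its new
-- place. This is the initial bound 3.
light⇒near-push : ∀ {n} {s : State n} → Light s → Near s (push s)
light⇒near-push {n} (settled {xs}) = extra-pending refl
  (subst (_≤ᴺ 3) (sym (cong₂ _+_ (D-refl xs) (δ-free-full n))) (s≤s z≤n))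
light⇒near-push (pending {xs} {x} p) = extra-full (length-∷ʳ xs) (begin
  D (xs ∷ʳ full) (xs ∷ʳ full) + δ x full + δ free x
    ≤⟨ +-mono-≤ (+-mono-≤ (≤-reflexive (D-refl (xs ∷ʳ full))) (δ-full≤δ-free+1 x)) (≤-reflexive p) ⟩
  (δ x free + 1) + 1 ≡⟨ cong (λ k → k + 1 + 1) (trans (δ-comm x free) p) ⟩
  3 ∎)
  where open ≤-Reasoning

build-cong : ∀ n {r r′ : RequestVector n} → r ≗ r′ → build n r ≡ build n r′
build-cong zero    r≗r′ = cong (λ k → pushes k (settled [])) (r≗r′ zero)
build-cong (suc n) r≗r′ = cong₂ (λ k s → pushes k (lift s)) (r≗r′ _) (build-cong n (r≗r′ ∘ inject₁))

-- Below level `i` the two constructions coincide, at level `i` one of them makes an additional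
-- push, and above it both undergo the same operations, which preserve `Near`.
near-build : ∀ n {r r′ : RequestVector n} i → r′ i ≡ suc (r i) → (∀ k → k ≢ i → r′ k ≡ r k) →
             Near (build n r) (build n r′)
near-build zero {r} {r′} zero at-i _ rewrite at-i = light⇒near-push (light-build zero r)
near-build (suc n) {r} {r′} i at-i off-i with view i
... | ‵fromℕ
  rewrite at-i
        | build-cong n {r′ ∘ inject₁} {r ∘ inject₁} (λ k → off-i (inject₁ k) (fromℕ≢inject₁ ∘ sym))
  = light⇒near-push (light-build (suc n) r)
... | ‵inject₁ j
  rewrite off-i (fromℕ (suc n)) fromℕ≢inject₁
  = near-pushes (r (fromℕ (suc n))) (near-lift
      (near-build n j at-i (λ k k≢j → off-i (inject₁ k) (k≢j ∘ inject₁-injective))))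

-- The hypotheses only relate two vectors, so the bound can be read forwards for an insertion and
-- backwards for a deletion.
layout-near : ∀ {n} {r r′ : RequestVector n} i → r′ i ≡ suc (r i) → (∀ k → k ≢ i → r′ k ≡ r k) →
              δ (layout r) (layout r′) ≤ᴺ 7
layout-near {n} {r} {r′} i at-i off-i =
  ≤-trans (δ-first (entries (build n r)) _) (near-entries (near-build n i at-i off-i))

-- The layout is a code assignment

level-∩ : ∀ {n} (i : Fin (suc n)) b (F : VertexSet (suc n)) v →
          (F ∩ atLevel (inject₁ i)) (child b v) ≡ ((F ∘ child b) ∩ atLevel i) v
level-∩ i b F v = cong (F (child b v) ∧_)
  (does-⇔ (mk⇔ inject₁-injective (cong inject₁)) (inject₁ (level v) Fin.≟ inject₁ i) (level v Fin.≟ i))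

occupied : ∀ {n} → Fin (suc n) → Code n → ℕ
occupied i c = ∣ ⟦ c ⟧ ∩ atLevel i ∣

occupied-free : ∀ {n} (i : Fin (suc n)) → occupied i free ≡ 0
occupied-free {n} i = card-∅ n

occupied-node : ∀ {n} (i : Fin (suc n)) (a b : Code n) →
                occupied (inject₁ i) (node a b) ≡ occupied i a + occupied i b
occupied-node i a b = trans (card-child (⟦ node a b ⟧ ∩ atLevel (inject₁ i)))
  (cong₂ _+_ (card-cong (level-∩ i false ⟦ node a b ⟧)) (card-cong (level-∩ i true ⟦ node a b ⟧)))

occupied-node-top : ∀ {n} (a b : Code n) → occupied (fromℕ (suc n)) (node a b) ≡ 0
occupied-node-top {n} a b = trans (card-cong empty) (card-∅ (suc n))
  where
  not-top : ∀ x (v : Vertex n) → atLevel (fromℕ (suc n)) (child x v) ≡ false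
  not-top x v = dec-false (inject₁ (level v) Fin.≟ fromℕ (suc n)) (fromℕ≢inject₁ ∘ sym)
  empty : (⟦ node a b ⟧ ∩ atLevel (fromℕ (suc n))) ≗ ∅
  empty root = refl
  empty (child false v) = trans (cong (⟦ a ⟧ v ∧_) (not-top false v)) (∧-zeroʳ _)
  empty (child true v)  = trans (cong (⟦ b ⟧ v ∧_) (not-top true v)) (∧-zeroʳ _)

occupied-full-top : ∀ n → occupied (fromℕ n) full ≡ 1
occupied-full-top n = trans (card-cong only-root) (card-⁅⁆ {n} root)
  where
  only-root : (⟦ full ⟧ ∩ atLevel (fromℕ n)) ≗ ⁅ root ⁆
  only-root root        = dec-true (fromℕ n Fin.≟ fromℕ n) refl
  only-root (child b v) = refl

occupied-full : ∀ {n} (i : Fin n) → occupied (inject₁ i) full ≡ 0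
occupied-full {n} i = trans (card-cong empty) (card-∅ n)
  where
  empty : (⟦ full ⟧ ∩ atLevel (inject₁ i)) ≗ ∅
  empty root        = dec-false (fromℕ n Fin.≟ inject₁ i) fromℕ≢inject₁
  empty (child b v) = refl

occupiedᴿ : ∀ {n} → Fin (suc n) → Row n → ℕ
occupiedᴿ i []       = 0
occupiedᴿ i (x ∷ xs) = occupied i x + occupiedᴿ i xs

occupiedᴿ-∷ʳ : ∀ {n} (i : Fin (suc n)) xs x → occupiedᴿ i (xs ∷ʳ x) ≡ occupiedᴿ i xs + occupied i x
occupiedᴿ-∷ʳ i []       x = +-identityʳ _
occupiedᴿ-∷ʳ i (a ∷ xs) x =
  trans (cong (occupied i a +_) (occupiedᴿ-∷ʳ i xs x)) (sym (+-assoc (occupied i a) _ _))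

occupiedᴿ-pair : ∀ {n} (i : Fin (suc n)) xs → occupiedᴿ (inject₁ i) (pair xs) ≡ occupiedᴿ i xs
occupiedᴿ-pair i []           = refl
occupiedᴿ-pair i (x ∷ [])     = cong (_+ 0)
  (trans (occupied-node i x free) (trans (cong (occupied i x +_) (occupied-free i)) (+-identityʳ _)))
occupiedᴿ-pair i (x ∷ y ∷ zs) =
  trans (cong₂ _+_ (occupied-node i x y) (occupiedᴿ-pair i zs)) (+-assoc (occupied i x) _ _)

occupiedᴿ-pair-top : ∀ {n} (xs : Row n) → occupiedᴿ (fromℕ (suc n)) (pair xs) ≡ 0
occupiedᴿ-pair-top []           = refl
occupiedᴿ-pair-top (x ∷ [])     = cong (_+ 0) (occupied-node-top x free)
occupiedᴿ-pair-top (x ∷ y ∷ zs) = cong₂ _+_ (occupied-node-top x y) (occupiedᴿ-pair-top zs)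

entries-push : ∀ {n} (i : Fin (suc n)) s →
               occupiedᴿ i (entries (push s)) ≡ occupied i full + occupiedᴿ i (entries s)
entries-push i (settled xs)   = trans (occupiedᴿ-∷ʳ i xs full) (+-comm (occupiedᴿ i xs) _)
entries-push i (pending xs x) = begin
  occupiedᴿ i (xs ∷ʳ full ∷ʳ x)                          ≡⟨ occupiedᴿ-∷ʳ i (xs ∷ʳ full) x ⟩
  occupiedᴿ i (xs ∷ʳ full) + occupied i x                ≡⟨ cong (_+ occupied i x) (trans (occupiedᴿ-∷ʳ i xs full) (+-comm (occupiedᴿ i xs) _)) ⟩
  (occupied i full + occupiedᴿ i xs) + occupied i x      ≡⟨ +-assoc (occupied i full) _ _ ⟩
  occupied i full + (occupiedᴿ i xs + occupied i x)      ≡⟨ cong (occupied i full +_) (occupiedᴿ-∷ʳ i xs x) ⟨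
  occupied i full + occupiedᴿ i (xs ∷ʳ x)                ∎
  where open ≡-Reasoning

entries-pushes : ∀ {n} (i : Fin (suc n)) k s →
                 occupiedᴿ i (entries (pushes k s)) ≡ k * occupied i full + occupiedᴿ i (entries s)
entries-pushes i zero    s = refl
entries-pushes i (suc k) s = trans (entries-push i (pushes k s))
  (trans (cong (occupied i full +_) (entries-pushes i k s)) (sym (+-assoc (occupied i full) _ _)))

entries-lift : ∀ {n} (i : Fin (suc n)) s →
               occupiedᴿ (inject₁ i) (entries (lift s)) ≡ occupiedᴿ i (entries s)
entries-lift i (settled xs)   = occupiedᴿ-pair i xs
entries-lift i (pending xs x) with parity (length xs)
... | 1ℙ = occupiedᴿ-pair i (xs ∷ʳ x)
... | 0ℙ = begin
  occupiedᴿ (inject₁ i) (pair xs ∷ʳ node x free)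
    ≡⟨ occupiedᴿ-∷ʳ (inject₁ i) (pair xs) (node x free) ⟩
  occupiedᴿ (inject₁ i) (pair xs) + occupied (inject₁ i) (node x free)
    ≡⟨ cong₂ _+_ (occupiedᴿ-pair i xs)
         (trans (occupied-node i x free) (trans (cong (occupied i x +_) (occupied-free i)) (+-identityʳ _))) ⟩
  occupiedᴿ i xs + occupied i x
    ≡⟨ occupiedᴿ-∷ʳ i xs x ⟨
  occupiedᴿ i (xs ∷ʳ x) ∎
  where open ≡-Reasoning

entries-lift-top : ∀ {n} (s : State n) → occupiedᴿ (fromℕ (suc n)) (entries (lift s)) ≡ 0
entries-lift-top (settled xs)   = occupiedᴿ-pair-top xs
entries-lift-top (pending xs x) with parity (length xs)
... | 1ℙ = occupiedᴿ-pair-top (xs ∷ʳ x)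
... | 0ℙ = trans (occupiedᴿ-∷ʳ (fromℕ _) (pair xs) (node x free))
             (cong₂ _+_ (occupiedᴿ-pair-top xs) (occupied-node-top x free))

-- A `full` subtree counts at its top level alone, and lifting adds only free space. Each level thus
-- owes its codes to the pushes made there.
entries-build : ∀ n (r : RequestVector n) i → occupiedᴿ i (entries (build n r)) ≡ r i
entries-build n r i with view i
entries-build zero r _ | ‵fromℕ = trans (entries-pushes zero (r zero) (settled []))
  (trans (+-identityʳ _) (trans (cong (r zero *_) (occupied-full-top 0)) (*-identityʳ _)))
entries-build (suc n) r _ | ‵fromℕ = begin
  occupiedᴿ top (entries (pushes (r top) s))               ≡⟨ entries-pushes top (r top) s ⟩
  r top * occupied top full + occupiedᴿ top (entries s)    ≡⟨ cong₂ (λ a b → r top * a + b) (occupied-full-top (suc n)) (entries-lift-top (build n (r ∘ inject₁))) ⟩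
  r top * 1 + 0                                            ≡⟨ trans (+-identityʳ _) (*-identityʳ _) ⟩
  r top                                                    ∎
  where
  open ≡-Reasoning
  top = fromℕ (suc n)
  s   = lift (build n (r ∘ inject₁))
entries-build (suc n) r _ | ‵inject₁ j = begin
  occupiedᴿ i (entries (pushes k s))               ≡⟨ entries-pushes i k s ⟩
  k * occupied i full + occupiedᴿ i (entries s)    ≡⟨ cong₂ (λ a b → k * a + b) (occupied-full j) (entries-lift j (build n (r ∘ inject₁))) ⟩
  k * 0 + occupiedᴿ j (entries (build n (r ∘ inject₁))) ≡⟨ cong₂ _+_ (*-zeroʳ k) (entries-build n (r ∘ inject₁) j) ⟩
  r i                                              ∎
  where
  open ≡-Reasoning
  i = inject₁ j
  k = r (fromℕ (suc n))
  s = lift (build n (r ∘ inject₁))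

-- Bandwidth and the length of rows

bandwidth : ∀ {n} → RequestVector n → ℕ
bandwidth r = sum λ k → r k * 2 ^ toℕ k

bandwidth-init : ∀ {n} (r : RequestVector (suc n)) →
                 bandwidth r ≡ bandwidth (r ∘ inject₁) + r (fromℕ (suc n)) * 2 ^ suc n
bandwidth-init {n} r = trans (sum-init-last (λ k → r k * 2 ^ toℕ k)) (cong₂ _+_
  (sum-cong-≗ λ k → cong (λ e → r (inject₁ k) * 2 ^ e) (toℕ-inject₁ k))
  (cong (λ e → r (fromℕ (suc n)) * 2 ^ e) (toℕ-fromℕ (suc n))))

length-push : ∀ {n} (s : State n) → length (entries (push s)) ≡ suc (length (entries s))
length-push (settled xs)   = length-∷ʳ xs
length-push (pending xs x) = trans (length-∷ʳ (xs ∷ʳ full)) (cong suc (trans (length-∷ʳ xs) (sym (length-∷ʳ xs))))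

length-pushes : ∀ {n} k (s : State n) → length (entries (pushes k s)) ≡ k + length (entries s)
length-pushes zero    s = refl
length-pushes (suc k) s = trans (length-push (pushes k s)) (cong suc (length-pushes k s))

-- Whether the pending subtree is placed or kept, the row is as long as after plain pairing:
-- postponing wastes no space.
length-lift : ∀ {n} (s : State n) → length (entries (lift s)) ≡ ⌈ length (entries s) /2⌉
length-lift (settled xs)   = length-pair xs
length-lift (pending xs x) with parity-suc (length xs)
... | inj₁ (p , _ , ceil) rewrite lift-even xs {x} p =
  trans (length-∷ʳ (pair xs)) (trans (cong suc (length-pair xs)) (trans (sym ceil) (cong ⌈_/2⌉ (sym (length-∷ʳ xs)))))
... | inj₂ (p , _ , _) rewrite lift-odd xs {x} p = length-pair (xs ∷ʳ x)

2*⌈n/2⌉≤1+n : ∀ n → 2 * ⌈ n /2⌉ ≤ᴺ suc n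
2*⌈n/2⌉≤1+n zero          = z≤n
2*⌈n/2⌉≤1+n (suc zero)    = ≤-refl
2*⌈n/2⌉≤1+n (suc (suc n)) = ≤-trans (≤-reflexive (*-suc 2 ⌈ n /2⌉)) (s≤s (s≤s (2*⌈n/2⌉≤1+n n)))

-- Measured in leaves, the row exceeds the bandwidth in use by less than one subtree. Pairing adds
-- at most one free subtree of the old height, and together with the old excess this is still less
-- than one of the new height.
length-build : ∀ n (r : RequestVector n) → length (entries (build n r)) * 2 ^ n < bandwidth r + 2 ^ n
length-build zero r = ≤-reflexive (trans (cong (λ l → suc (l * 1)) (length-pushes (r zero) (settled [])))
  (rearrange (r zero)))
  where
  rearrange : ∀ a → suc ((a + 0) * 1) ≡ (a * 1 + 0) + 1
  rearrange = solve-∀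
length-build (suc n) r = begin-strict
  length (entries (pushes k (lift s))) * (2 * 2 ^ n)
    ≡⟨ cong (_* (2 * 2 ^ n)) (trans (length-pushes k (lift s)) (cong (k +_) (length-lift s))) ⟩
  (k + ⌈ l /2⌉) * (2 * 2 ^ n)            ≡⟨ rearrange₁ k ⌈ l /2⌉ (2 ^ n) ⟩
  2 * ⌈ l /2⌉ * 2 ^ n + k * (2 * 2 ^ n)  ≤⟨ +-monoˡ-≤ _ (*-monoˡ-≤ (2 ^ n) (2*⌈n/2⌉≤1+n l)) ⟩
  suc l * 2 ^ n + k * (2 * 2 ^ n)        ≡⟨ rearrange₂ (l * 2 ^ n) (2 ^ n) (k * (2 * 2 ^ n)) ⟩
  l * 2 ^ n + (2 ^ n + k * (2 * 2 ^ n))  <⟨ +-monoˡ-< _ (length-build n (r ∘ inject₁)) ⟩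
  (bandwidth (r ∘ inject₁) + 2 ^ n) + (2 ^ n + k * (2 * 2 ^ n))
    ≡⟨ rearrange₃ (bandwidth (r ∘ inject₁)) (2 ^ n) (k * (2 * 2 ^ n)) ⟩
  (bandwidth (r ∘ inject₁) + k * 2 ^ suc n) + 2 ^ suc n
    ≡⟨ cong (_+ 2 ^ suc n) (bandwidth-init r) ⟨
  bandwidth r + 2 ^ suc n ∎
  where
  open ≤-Reasoning
  k = r (fromℕ (suc n))
  s = build n (r ∘ inject₁)
  l = length (entries s)
  rearrange₁ : ∀ k c p → (k + c) * (2 * p) ≡ 2 * c * p + k * (2 * p)
  rearrange₁ = solve-∀
  rearrange₂ : ∀ a p b → (p + a) + b ≡ a + (p + b)
  rearrange₂ = solve-∀
  rearrange₃ : ∀ a p b → (a + p) + (p + b) ≡ (a + b) + 2 * p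
  rearrange₃ = solve-∀

occupied-first : ∀ {n} (i : Fin (suc n)) xs → length xs < 2 → occupied i (first xs) ≡ occupiedᴿ i xs
occupied-first i []       _ = occupied-free i
occupied-first i (x ∷ []) _ = sym (+-identityʳ _)
occupied-first i (_ ∷ _ ∷ _) (s≤s (s≤s ()))

layout-isCodeAssignment : ∀ {n} (r : RequestVector n) → bandwidth r ≤ᴺ 2 ^ n →
                          IsCodeAssignment r ⟦ layout r ⟧
layout-isCodeAssignment {n} r enough = record
  { atMostOne  = λ ℓ _ → ⟦⟧-atMostOne (layout r) ℓ
  ; levelCount = λ i → trans (occupied-first i (entries (build n r)) short) (entries-build n r i)
  }
  where
  open ≤-Reasoning
  short : length (entries (build n r)) < 2
  -- The strict bound matters: even at full bandwidth a second subtree is excluded.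
  short = *-cancelʳ-< (2 ^ n) _ 2 (begin-strict
    length (entries (build n r)) * 2 ^ n <⟨ length-build n r ⟩
    bandwidth r + 2 ^ n  ≤⟨ +-monoˡ-≤ (2 ^ n) enough ⟩
    2 ^ n + 2 ^ n        ≡⟨ cong (2 ^ n +_) (+-identityʳ (2 ^ n)) ⟨
    2 * 2 ^ n            ∎)

-- Deletions

∖-⁅⁆-card : ∀ {n} (F : VertexSet n) v → v ∈ F → ∣ F ∣ ≡ suc ∣ F ∖ ⁅ v ⁆ ∣
∖-⁅⁆-card F v v∈F = ≤-antisym
  (≤-trans (card-≤-+ ⁅ v ⁆ (F ∖ ⁅ v ⁆) λ u → upper (F u) (⁅ v ⁆ u))
    (≤-reflexive (cong (_+ ∣ F ∖ ⁅ v ⁆ ∣) (card-⁅⁆ v))))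
  (≤-trans (≤-reflexive (sym (cong (_+ ∣ F ∖ ⁅ v ⁆ ∣) (card-⁅⁆ v))))
    (card-+-≤ ⁅ v ⁆ (F ∖ ⁅ v ⁆) lower))
  where
  upper : ∀ a b → ind a ≤ᴺ ind b + ind (a ∧ not b)
  upper false b     = z≤n
  upper true  false = ≤-refl
  upper true  true  = ≤-refl
  lower : ∀ u → ind (⁅ v ⁆ u) + ind ((F ∖ ⁅ v ⁆) u) ≤ᴺ ind (F u)
  lower u with u ≟ v
  ... | yes refl rewrite v∈F = ≤-refl
  ... | no _ with F u
  ...   | false = z≤n
  ...   | true  = ≤-refl

deletion-isCodeAssignment : ∀ {n} {r : RequestVector n} {F} v → v ∈ F → IsCodeAssignment r F →
                            IsCodeAssignment (update r (deletion v)) (F ∖ ⁅ v ⁆)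
deletion-isCodeAssignment {n} {r} {F} v v∈F code = record
  { atMostOne  = λ ℓ leaf u∈ w∈ u∈F w∈F → atMostOne ℓ leaf u∈ w∈ (∖⊆ _ u∈F) (∖⊆ _ w∈F)
  ; levelCount = count-at
  }
  where
  open IsCodeAssignment code
  ∖⊆ : ∀ u → u ∈ F ∖ ⁅ v ⁆ → u ∈ F
  ∖⊆ u u∈ with F u
  ... | true = refl
  ... | false = u∈
  swap : ∀ i → ((F ∖ ⁅ v ⁆) ∩ atLevel i) ≗ ((F ∩ atLevel i) ∖ ⁅ v ⁆)
  swap i u = trans (∧-assoc (F u) _ _)
    (trans (cong (F u ∧_) (∧-comm (not (⁅ v ⁆ u)) _)) (sym (∧-assoc (F u) _ _)))
  count-at : ∀ i → ∣ (F ∖ ⁅ v ⁆) ∩ atLevel i ∣ ≡ updateAt r (level v) pred i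
  count-at i with level v Fin.≟ i
  ... | yes refl = begin
    ∣ (F ∖ ⁅ v ⁆) ∩ atLevel i ∣    ≡⟨ card-cong (swap i) ⟩
    ∣ (F ∩ atLevel i) ∖ ⁅ v ⁆ ∣    ≡⟨ cong pred (∖-⁅⁆-card (F ∩ atLevel i) v v∈level) ⟨
    pred ∣ F ∩ atLevel i ∣         ≡⟨ cong pred (levelCount i) ⟩
    pred (r i)                     ≡⟨ updateAt-updates i r ⟨
    updateAt r i pred i            ∎
    where
    open ≡-Reasoning
    v∈level : v ∈ F ∩ atLevel (level v)
    v∈level = cong₂ _∧_ v∈F (dec-true (level v Fin.≟ level v) refl)
  ... | no v≢i = begin
    ∣ (F ∖ ⁅ v ⁆) ∩ atLevel i ∣    ≡⟨ card-cong same ⟩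
    ∣ F ∩ atLevel i ∣              ≡⟨ levelCount i ⟩
    r i                            ≡⟨ updateAt-minimal i (level v) r (v≢i ∘ sym) ⟨
    updateAt r (level v) pred i    ∎
    where
    open ≡-Reasoning
    same : ((F ∖ ⁅ v ⁆) ∩ atLevel i) ≗ (F ∩ atLevel i)
    same u with u ≟ v
    ... | no _ = cong (_∧ atLevel i u) (∧-identityʳ (F u))
    ... | yes refl rewrite dec-false (level u Fin.≟ i) v≢i = trans (∧-zeroʳ _) (sym (∧-zeroʳ _))

-- The assigned vertex makes the entry positive, so `pred` really lowers it and a deletion is the
-- reverse of adding a code.
assigned⇒requested : ∀ {n} {r : RequestVector n} {F} v → v ∈ F → IsCodeAssignment r F →
                     r (level v) ≡ suc (update r (deletion v) (level v))
assigned⇒requested {r = r} {F} v v∈F code = trans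
  (positive (trans (sym (levelCount (level v))) (∖-⁅⁆-card (F ∩ atLevel (level v)) v v∈level)))
  (cong suc (sym (updateAt-updates (level v) r)))
  where
  open IsCodeAssignment code
  v∈level : v ∈ F ∩ atLevel (level v)
  v∈level = cong₂ _∧_ v∈F (dec-true (level v Fin.≟ level v) refl)
  positive : ∀ {a b} → a ≡ suc b → a ≡ suc (pred a)
  positive refl = refl

sum-mono : ∀ {n} {f g : Vector ℕ n} → (∀ i → f i ≤ᴺ g i) → sum f ≤ᴺ sum g
sum-mono {zero}  f≤g = z≤n
sum-mono {suc n} f≤g = +-mono-≤ (f≤g zero) (sum-mono (f≤g ∘ suc))

deletion-bandwidth : ∀ {n} (r : RequestVector n) v → bandwidth (update r (deletion v)) ≤ᴺ bandwidth r
deletion-bandwidth r v = sum-mono λ k → *-monoˡ-≤ (2 ^ toℕ k) (pred-at-≤ k)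
  where
  pred-at-≤ : ∀ k → updateAt r (level v) pred k ≤ᴺ r k
  pred-at-≤ k with k Fin.≟ level v
  ... | yes refl = ≤-trans (≤-reflexive (updateAt-updates k r)) pred[n]≤n
  ... | no  k≢v  = ≤-reflexive (updateAt-minimal k (level v) r k≢v)

-- The algorithm

algorithm : OnlineAlgorithm
algorithm n h i = ⟦ layout (update (requestVector h) (insertion i)) ⟧

record Valid {n} (h : History n) : Set where
  field
    enough : bandwidth (requestVector h) ≤ᴺ 2 ^ n
    code   : IsCodeAssignment (requestVector h) (assignment h)

-- The potential: canonical vertices that an insertion may still have to assign.
lag : ∀ {n} → History n → ℕ
lag h = ∣ ⟦ layout (requestVector h) ⟧ ∖ assignment h ∣

after : ∀ {n} → History n → Request n → History n
after h R = (R , serve algorithm h R) ∷ h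

valid-[] : ∀ {n} → Valid {n} []
valid-[] {n} = record
  { enough = ≤-trans (≤-reflexive (sum-replicate-zero (suc n))) z≤n
  ; code   = record { atMostOne = λ _ _ _ _ () ; levelCount = λ _ → card-∅ n }
  }

valid-after : ∀ {n} {h : History n} R → Valid h → Admissible h R → Valid (after h R)
valid-after (insertion i) _ enough = record
  { enough = enough ; code = layout-isCodeAssignment _ enough }
valid-after {h = h} (deletion v) valid v∈F = record
  { enough = ≤-trans (deletion-bandwidth (requestVector h) v) (Valid.enough valid)
  ; code   = deletion-isCodeAssignment v v∈F (Valid.code valid)
  }

layout-update : ∀ {n} {h : History n} R → Valid h → Admissible h R →
                ∣ ⟦ layout (requestVector (after h R)) ⟧ △ ⟦ layout (requestVector h) ⟧ ∣ ≤ᴺ 7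
layout-update {h = h} (insertion i) _ _ = ≤-trans
  (≤-reflexive (trans (△-comm ⟦ layout r′ ⟧ ⟦ layout r ⟧) (sym (δ-card (layout r) (layout r′)))))
  (layout-near i (updateAt-updates i r) λ k k≢i → updateAt-minimal k i r k≢i)
  where
  r  = requestVector h
  r′ = updateAt r i suc
layout-update {h = h} (deletion v) valid v∈F = ≤-trans
  (≤-reflexive (sym (δ-card (layout r′) (layout r))))
  (layout-near (level v) (assigned⇒requested v v∈F (Valid.code valid))
    λ k k≢v → sym (updateAt-minimal k (level v) r k≢v))
  where
  r  = requestVector h
  r′ = updateAt r (level v) pred

∖-self : ∀ {n} (F : VertexSet n) → ∣ F ∖ F ∣ ≡ 0
∖-self {n} F = trans (card-cong λ v → ∧-inverseʳ (F v)) (card-∅ n)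

-- An insertion pays the old lag and at most 7 for the change of layout, and leaves no lag. A
-- deletion is free of cost and raises the lag by at most 7 for the layout and 1 for the vertex
-- deleted.
amortized : ∀ {n} {h : History n} R → Valid h → Admissible h R →
            ∣ assignment (after h R) ∖ assignment h ∣ + lag (after h R) ≤ᴺ 8 + lag h
amortized {h = h} R@(insertion i) valid adm = begin
  ∣ G′ ∖ F ∣ + ∣ G′ ∖ G′ ∣   ≡⟨ trans (cong (∣ G′ ∖ F ∣ +_) (∖-self G′)) (+-identityʳ _) ⟩
  ∣ G′ ∖ F ∣                 ≤⟨ ∖-triangle G′ G F ⟩
  ∣ G′ △ G ∣ + ∣ G ∖ F ∣     ≤⟨ +-monoˡ-≤ _ (≤-trans (layout-update R valid adm) (n≤1+n 7)) ⟩
  8 + ∣ G ∖ F ∣              ∎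
  where
  open ≤-Reasoning
  F  = assignment h
  G  = ⟦ layout (requestVector h) ⟧
  G′ = ⟦ layout (requestVector (after h R)) ⟧
amortized {n} {h} R@(deletion v) valid adm = begin
  ∣ F ∖ ⁅ v ⁆ ∖ F ∣ + ∣ G′ ∖ (F ∖ ⁅ v ⁆) ∣        ≡⟨ cong (_+ ∣ G′ ∖ (F ∖ ⁅ v ⁆) ∣) (trans (card-cong nothing-new) (card-∅ n)) ⟩
  ∣ G′ ∖ (F ∖ ⁅ v ⁆) ∣                            ≤⟨ card-≤-+ ⁅ v ⁆ (G′ ∖ F) (λ u → deleted (G′ u) (F u) (⁅ v ⁆ u)) ⟩
  ∣ ⁅ v ⁆ ∣ + ∣ G′ ∖ F ∣                          ≡⟨ cong (_+ ∣ G′ ∖ F ∣) (card-⁅⁆ v) ⟩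
  1 + ∣ G′ ∖ F ∣                                  ≤⟨ s≤s (∖-triangle G′ G F) ⟩
  1 + (∣ G′ △ G ∣ + ∣ G ∖ F ∣)                    ≤⟨ s≤s (+-monoˡ-≤ _ (layout-update R valid adm)) ⟩
  8 + ∣ G ∖ F ∣                                   ∎
  where
  open ≤-Reasoning
  F  = assignment h
  G  = ⟦ layout (requestVector h) ⟧
  G′ = ⟦ layout (requestVector (after h R)) ⟧
  nothing-new : (F ∖ ⁅ v ⁆ ∖ F) ≗ ∅
  nothing-new u with F u
  ... | false = refl
  ... | true  = ∧-zeroʳ _
  deleted : ∀ a b c → ind (a ∧ not (b ∧ not c)) ≤ᴺ ind c + ind (a ∧ not b)
  deleted false _     _     = z≤n
  deleted true  false false = ≤-refl
  deleted true  false true  = m≤m+n 1 1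
  deleted true  true  false = ≤-refl
  deleted true  true  true  = ≤-refl

-- Summation over a sequence of requests

module _ {n : ℕ} where

  AdmissibleFrom : ∀ {m} → History n → Vector (Request n) m → Set
  AdmissibleFrom h R = ∀ t → Admissible (serveFrom algorithm h R (inject₁ t)) (R t)

  valid-serveFrom : ∀ {m} {h : History n} (R : Vector (Request n) m) → Valid h → AdmissibleFrom h R →
                    ∀ t → Valid (serveFrom algorithm h R t)
  valid-serveFrom         R valid adm zero    = valid
  valid-serveFrom {suc m} R valid adm (suc t) =
    valid-serveFrom (R ∘ suc) (valid-after (R zero) valid (adm zero)) (adm ∘ suc) t

  -- The amortized bounds telescope. The starting history is arbitrary so that induction can remove
  -- the first request.
  total-reassignments : ∀ {m} {h : History n} (R : Vector (Request n) m) → Valid h → AdmissibleFrom h R →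
    sum (λ t → ∣ assignment (serveFrom algorithm h R (suc t)) ∖ assignment (serveFrom algorithm h R (inject₁ t)) ∣)
      ≤ᴺ m * 8 + lag h
  total-reassignments {zero}      R valid adm = z≤n
  total-reassignments {suc m} {h} R valid adm = begin
    cost + _                       ≤⟨ +-monoʳ-≤ cost (total-reassignments (R ∘ suc)
                                        (valid-after (R zero) valid (adm zero)) (adm ∘ suc)) ⟩
    cost + (m * 8 + lag h′)        ≡⟨ x∙yz≈y∙xz cost (m * 8) (lag h′) ⟩
    m * 8 + (cost + lag h′)        ≤⟨ +-monoʳ-≤ (m * 8) (amortized (R zero) valid (adm zero)) ⟩
    m * 8 + (8 + lag h)            ≡⟨ regroup (m * 8) (lag h) ⟩
    suc m * 8 + lag h              ∎
    where
    open ≤-Reasoning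
    h′   = after h (R zero)
    cost = ∣ assignment h′ ∖ assignment h ∣
    regroup : ∀ a b → a + (8 + b) ≡ 8 + a + b
    regroup = solve-∀

build-zero : ∀ n → build n (λ _ → 0) ≡ settled []
build-zero zero    = refl
build-zero (suc n) = cong lift (build-zero n)

lag-[] : ∀ n → lag {n} [] ≡ 0
lag-[] n rewrite build-zero n = card-∅ n

-- Between unnormalised fractions the inequality is cross-multiplication in the integers.
/≤⇐≤* : ∀ {a m c} .{{_ : NonZero m}} → a ≤ᴺ m * c → ℤ.+ a ℚ./ m ≤ ℤ.+ c ℚ./ 1
/≤⇐≤* {a} {m@(suc _)} {c} a≤mc = ℚ.toℚᵘ-cancel-≤ (begin
  ℚ.toℚᵘ (ℤ.+ a ℚ./ m)  ≃⟨ ℚ.toℚᵘ-fromℚᵘ (ℤ.+ a ℚᵘ./ m) ⟩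
  ℤ.+ a ℚᵘ./ m          ≤⟨ ℚᵘ.*≤* (ℤ.≤-trans (ℤ.≤-reflexive (ℤ.*-identityʳ (ℤ.+ a)))
                          (ℤ.≤-trans (ℤ.+≤+ (≤-trans a≤mc (≤-reflexive (*-comm m c)))) (ℤ.≤-reflexive (ℤ.pos-* c m)))) ⟩
  ℤ.+ c ℚᵘ./ 1          ≃⟨ ℚ.toℚᵘ-fromℚᵘ (ℤ.+ c ℚᵘ./ 1) ⟨
  ℚ.toℚᵘ (ℤ.+ c ℚ./ 1)  ∎)
  where open ℚᵘ.≤-Reasoning

mainTheorem1 : Σ[ c ∈ ℚ ] Σ[ A ∈ OnlineAlgorithm ]
    (SolvesCodeReallocation A ×
    (∀ n m .{{_ : NonZero m}} (R : Vector (Request n) m) →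
    AdmissibleSequence A R → averageReassignments A R ≤ c))
mainTheorem1 = ℤ.+ 8 ℚ./ 1 , algorithm
  , (λ n m R adm t → Valid.code (valid-serveFrom R valid-[] adm t))
  , λ n m R adm → /≤⇐≤* (subst (λ l → sum (reassignments algorithm R) ≤ᴺ l)
      (trans (cong (m * 8 +_) (lag-[] n)) (+-identityʳ _)) (total-reassignments R valid-[] adm))
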